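{- Let $G$ be a bipartite cactus graph with $n\ge4$ vertices and $m$ edges, with degree sequence $d$, and suppose $\beta\ge 1$, where $\beta=\max\{\mu_1,\tfrac12(\mu_1+\mu_{odd})\}$. Then $m\le \left\lfloor\frac{4(n-1)-\beta}{3}\right\rfloor$.
   Context: A cactus graph is a connected simple graph in which every edge belongs to at most one cycle; a bi-cactus is a bipartite cactus. For the degree sequence $d$, $\mu_1$ is the number of entries equal to $1$ and $\mu_{odd}$ is the number of entries that are odd integers greater than $1$. -}

module Defs where

open import Data.Bool.Base using (Bool)
open import Data.Fin.Base using (Fin)
import Data.Fin.Properties as Fin
open import Data.Integer.Base using (+_)
open import Data.List.Base using (List; _∷_; _∷ʳ_; length; filter; map; allFin; cartesianProduct)
open import Data.List.Relation.Unary.Linked using (Linked)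
open import Data.List.Relation.Unary.Unique.Propositional using (Unique)
open import Data.Nat.Base using (ℕ; _+_; _≤_; _%_)
import Data.Nat.Properties as ℕ
open import Data.Product.Base using (Σ-syntax; proj₁; proj₂)
open import Data.Rational.Base using (ℚ; _/_; _⊔_)
open import Data.Sum.Base using (_⊎_)
open import Function.Bundles using (_⇔_)
open import Level using (0ℓ)
open import Relation.Binary.Construct.Closure.ReflexiveTransitive using (Star)
open import Relation.Binary.Core using (Rel)
open import Relation.Binary.Definitions using (Decidable; Symmetric; Irreflexive)
open import Relation.Binary.PropositionalEquality.Core using (_≡_; _≢_)
open import Relation.Nullary.Decidable using (_×-dec_)

record SimpleGraph (n : ℕ) : Set₁ where
  infix 4 _~_ _~?_
  field
    _~_    : Rel (Fin n) 0ℓ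
    _~?_   : Decidable _~_
    sym    : Symmetric _~_
    irrefl : Irreflexive _≡_ _~_

module _ {n : ℕ} (G : SimpleGraph n) where
  open SimpleGraph G

  -- Each edge {u , v} is counted once, as the pair with u < v.
  edgeCount : ℕ
  edgeCount =
    length (filter (λ e → (proj₁ e Fin.<? proj₂ e) ×-dec (proj₁ e ~? proj₂ e))
                   (cartesianProduct (allFin n) (allFin n)))

  degree : Fin n → ℕ
  degree u = length (filter (u ~?_) (allFin n))

  degreeSequence : List ℕ
  degreeSequence = map degree (allFin n)

  Connected : Set
  Connected = ∀ u v → Star _~_ u v

  Bipartite : Set
  Bipartite = Σ[ side ∈ (Fin n → Bool) ] (∀ u v → u ~ v → side u ≢ side v)

data Consecutive {A : Set} (x y : A) : List A → Set where
  here  : ∀ {zs}   → Consecutive x y (x ∷ y ∷ zs)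
  there : ∀ {z zs} → Consecutive x y zs → Consecutive x y (z ∷ zs)

module _ {n : ℕ} (G : SimpleGraph n) where
  open SimpleGraph G

  -- A cycle together with a choice of starting vertex and direction.
  record Cycle : Set where
    field
      start  : Fin n
      others : List (Fin n)

    vertices : List (Fin n)
    vertices = start ∷ others

    closedWalk : List (Fin n)
    closedWalk = vertices ∷ʳ start

    field
      long   : 3 ≤ length vertices
      unique : Unique vertices
      linked : Linked _~_ closedWalk

  EdgeOf : Cycle → Rel (Fin n) 0ℓ
  EdgeOf C u v = Consecutive u v closedWalk ⊎ Consecutive v u closedWalk
    where open Cycle C

  -- Cycles are compared as subgraphs, so that rotations and reversals of the
  -- vertex list do not count as different cycles.
  SameCycle : Rel Cycle 0ℓ
  SameCycle C D = ∀ u v → EdgeOf C u v ⇔ EdgeOf D u v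

  record IsCactus : Set where
    field
      connected : Connected G
      edgeInAtMostOneCycle :
        ∀ {u v} → u ~ v → ∀ C D → EdgeOf C u v → EdgeOf D u v → SameCycle C D

μ₁ : List ℕ → ℕ
μ₁ d = length (filter (ℕ._≟ 1) d)

μodd : List ℕ → ℕ
μodd d = length (filter (λ k → (k % 2 ℕ.≟ 1) ×-dec (1 ℕ.<? k)) d)

β : List ℕ → ℚ
β d = (+ μ₁ d / 1) ⊔ (+ (μ₁ d + μodd d) / 2)

{-# OPTIONS --safe #-}

-- Add the edges of G one at a time, keeping track of connected components.  An
-- edge within a component closes a cycle, of length at least 4 as G is
-- bipartite; all other edges merge components, so there are at most n - 1 of
-- them, and m + 1 ≤ n + c for the number c of closed cycles.  By the cactus
-- property these c cycles are edge-disjoint, so if B counts the remaining edges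
-- twice, once from each end, then B + 8 c ≤ 2 m, and hence B + 6 m ≤ 8 (n - 1).
-- Deleting cycles preserves the parity of degrees: every vertex of odd degree
-- keeps a remaining edge, whence B ≥ μ₁ + μodd, and the edge at a leaf remains;
-- no two leaves are adjacent, whence B ≥ 2 μ₁.  So B ≥ 2 β.

module Submission where

open import Defs
open import Data.Nat.Base as ℕ using (ℕ)
open import Data.Rational.Base using (1ℚ; _≤_; _/_; _-_; _÷_; floor)

open import Data.Bool.Base using (true; false; if_then_else_)
import Data.Bool.Properties as Bool
open import Data.Fin.Base as Fin using (Fin; zero; suc)
import Data.Fin.Properties as Fin
import Data.Integer.Base as ℤ
import Data.Integer.DivMod as ℤ
import Data.Integer.Properties as ℤ
open import Data.List.Base using (List; []; _∷_; _++_; _∷ʳ_; length; filter; map; tabulate; allFin; cartesianProduct)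
open import Data.List.Membership.DecPropositional using (_∈?_)
open import Data.List.Membership.Propositional using (_∈_)
open import Data.List.Properties using (length-++; filter-++; map-tabulate)
open import Data.List.Relation.Unary.All as All using (All; []; _∷_)
import Data.List.Relation.Unary.All.Properties as All
open import Data.List.Relation.Unary.AllPairs using ([]; _∷_)
open import Data.List.Relation.Unary.Any using (here; there)
open import Data.List.Relation.Unary.Linked as Linked using (Linked; [-]; _∷_)
open import Data.List.Relation.Unary.Unique.Propositional using (Unique)
import Data.List.Relation.Unary.Unique.Propositional.Properties as Unique
open import Data.Nat.DivMod using (m*n%n≡0)
open import Data.Product.Base using (_×_; _,_; proj₁; proj₂; ∃-syntax; Σ-syntax)
import Data.Rational.Properties as ℚ
import Data.Rational.Unnormalised.Base as ℚᵘ
import Data.Rational.Unnormalised.Properties as ℚᵘ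
open import Data.Sum.Base as Sum using (_⊎_; inj₁; inj₂; [_,_]′)
open import Function.Base using (_∘_; id)
open import Function.Bundles using (Equivalence)
open import Level using (0ℓ)
open import Relation.Binary.Construct.Closure.ReflexiveTransitive as Star using (Star; ε; _◅_; _◅◅_)
open import Relation.Binary.Core using (Rel; _⇒_)
open import Relation.Binary.Definitions using (tri<; tri≈; tri>)
open import Relation.Binary.PropositionalEquality
open import Relation.Nullary using (Dec; yes; no; does; ¬_; contradiction)
open import Relation.Nullary.Decidable using (_×-dec_)
open import Relation.Unary using (Pred; Decidable)

-- Floors and fractions

module Rounding where

  open import Data.Integer.Base using (+_)
  open import Data.Rational.Base
  open import Data.Rational.Properties

  -- Clearing the denominator of `q` gives `i * ↧ q ≤ ↥ q`, and division with remainder puts `↥ q`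
  -- strictly below `↧ q` times one more than the floor; then `↧ q` cancels.
  floor-greatest : ∀ i q → i / 1 ≤ q → i ℤ.≤ floor q
  floor-greatest i q@record{} i≤q = ℤ.≤-trans (ℤ.i<j⇒i≤pred[j] i<1+⌊q⌋)
    (ℤ.≤-reflexive (trans (ℤ.pred-suc _) (sym (ℤ.div-pos-is-/ℕ (↥ q) (↧ₙ q)))))
    where
    i*d≤n : i ℤ.* ↧ q ℤ.≤ ↥ q
    i*d≤n = subst (i ℤ.* ↧ q ℤ.≤_) (ℤ.*-identityʳ (↥ q))
      (ℚᵘ.drop-*≤* (ℚᵘ.≤-respˡ-≃ (toℚᵘ-fromℚᵘ (ℚᵘ.mkℚᵘ i 0)) (toℚᵘ-mono-≤ i≤q)))

    i<1+⌊q⌋ : i ℤ.< ℤ.suc (↥ q ℤ./ℕ ↧ₙ q)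
    i<1+⌊q⌋ = ℤ.*-cancelʳ-<-nonNeg (↧ q) (ℤ.≤-<-trans i*d≤n (ℤ.n<s[n/ℕd]*d (↥ q) (↧ₙ q)))

  -- Normalised fractions are handled through unnormalised ones, whose order and operations are
  -- integer formulas without reduction to lowest terms.
  fromℚᵘ-mono-≤ : ∀ {p q} → p ℚᵘ.≤ q → fromℚᵘ p ≤ fromℚᵘ q
  fromℚᵘ-mono-≤ {p} {q} p≤q = toℚᵘ-cancel-≤
    (ℚᵘ.≤-respˡ-≃ (ℚᵘ.≃-sym (toℚᵘ-fromℚᵘ p)) (ℚᵘ.≤-respʳ-≃ (ℚᵘ.≃-sym (toℚᵘ-fromℚᵘ q)) p≤q))

  fromℚᵘ-homo-+ : ∀ p q → fromℚᵘ (p ℚᵘ.+ q) ≡ fromℚᵘ p + fromℚᵘ q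
  fromℚᵘ-homo-+ p q = toℚᵘ-injective (ℚᵘ.≃-trans (toℚᵘ-fromℚᵘ (p ℚᵘ.+ q)) (ℚᵘ.≃-sym
    (ℚᵘ.≃-trans (toℚᵘ-homo-+ (fromℚᵘ p) (fromℚᵘ q)) (ℚᵘ.+-cong (toℚᵘ-fromℚᵘ p) (toℚᵘ-fromℚᵘ q)))))

  fromℚᵘ-homo-* : ∀ p q → fromℚᵘ (p ℚᵘ.* q) ≡ fromℚᵘ p * fromℚᵘ q
  fromℚᵘ-homo-* p q = toℚᵘ-injective (ℚᵘ.≃-trans (toℚᵘ-fromℚᵘ (p ℚᵘ.* q)) (ℚᵘ.≃-sym
    (ℚᵘ.≃-trans (toℚᵘ-homo-* (fromℚᵘ p) (fromℚᵘ q)) (ℚᵘ.*-cong (toℚᵘ-fromℚᵘ p) (toℚᵘ-fromℚᵘ q)))))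

  fromℕ-+ : ∀ a b → + (a ℕ.+ b) / 1 ≡ + a / 1 + + b / 1
  fromℕ-+ a b = trans (cong₂ (λ x y → (x ℤ.+ y) / 1) (sym (ℤ.*-identityʳ (+ a))) (sym (ℤ.*-identityʳ (+ b))))
    (fromℚᵘ-homo-+ (ℚᵘ.mkℚᵘ (+ a) 0) (ℚᵘ.mkℚᵘ (+ b) 0))

  /-mono-≤ : ∀ a b c d .{{_ : ℕ.NonZero b}} .{{_ : ℕ.NonZero d}} → a ℕ.* d ℕ.≤ c ℕ.* b → + a / b ≤ + c / d
  /-mono-≤ a b@(ℕ.suc _) c d@(ℕ.suc _) ad≤cb =
    fromℚᵘ-mono-≤ {ℚᵘ.mkℚᵘ (+ a) _} {ℚᵘ.mkℚᵘ (+ c) _}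
      (ℚᵘ.*≤* (subst₂ ℤ._≤_ (ℤ.pos-* a d) (ℤ.pos-* c b) (ℤ.+≤+ ad≤cb)))

  fromℕ-*3*⅓ : ∀ m → + (m ℕ.* 3) / 1 * (+ 1 / 3) ≡ + m / 1
  fromℕ-*3*⅓ m = trans (sym (fromℚᵘ-homo-* (ℚᵘ.mkℚᵘ (+ (m ℕ.* 3)) 0) (ℚᵘ.mkℚᵘ (+ 1) 2)))
    (fromℚᵘ-cong {ℚᵘ.mkℚᵘ (+ (m ℕ.* 3)) 0 ℚᵘ.* ℚᵘ.mkℚᵘ (+ 1) 2} {ℚᵘ.mkℚᵘ (+ m) 0}
      (ℚᵘ.*≡* (trans (ℤ.*-identityʳ _) (trans (ℤ.*-identityʳ _) (ℤ.pos-* m 3)))))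

  -- Here `t` is the slack above `m * 3`: taking away at most `t` leaves at least `m * 3`, a third
  -- of which is `m`. Division by `+ 3 / 1` computes to multiplication by `+ 1 / 3`.
  floor-÷3-greatest : ∀ m t (b : ℚ) → b ≤ + t / 1 → + m ℤ.≤ floor ((+ (m ℕ.* 3 ℕ.+ t) / 1 - b) ÷ (+ 3 / 1))
  floor-÷3-greatest m t b b≤t = floor-greatest (+ m) _ (begin
    + m / 1                                                ≡⟨ fromℕ-*3*⅓ m ⟨
    + (m ℕ.* 3) / 1 * (+ 1 / 3)                            ≤⟨ *-monoʳ-≤-nonNeg (+ 1 / 3) (begin
      + (m ℕ.* 3) / 1                                      ≡⟨ +-identityʳ _ ⟨
      + (m ℕ.* 3) / 1 + 0ℚ                                 ≡⟨ cong (λ z → + (m ℕ.* 3) / 1 + z) (+-inverseʳ (+ t / 1)) ⟨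
      + (m ℕ.* 3) / 1 + (+ t / 1 - + t / 1)                ≡⟨ +-assoc (+ (m ℕ.* 3) / 1) (+ t / 1) (- (+ t / 1)) ⟨
      + (m ℕ.* 3) / 1 + + t / 1 - + t / 1                  ≡⟨ cong (_- + t / 1) (fromℕ-+ (m ℕ.* 3) t) ⟨
      + (m ℕ.* 3 ℕ.+ t) / 1 - + t / 1                      ≤⟨ +-monoʳ-≤ (+ (m ℕ.* 3 ℕ.+ t) / 1) (neg-antimono-≤ b≤t) ⟩
      + (m ℕ.* 3 ℕ.+ t) / 1 - b                            ∎) ⟩
    (+ (m ℕ.* 3 ℕ.+ t) / 1 - b) * (+ 1 / 3)                ∎)
    where open ≤-Reasoning

open import Data.Nat.Base using (zero; suc; _+_; _*_; _∸_; _%_; _<_; z≤n; s≤s)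
open import Data.Nat.Properties
open import Data.Nat.Solver using (module +-*-Solver)
open import Algebra.Properties.Semiring.Sum +-*-semiring
  using (sum; sum-syntax; sum-cong-≗; ∑-distrib-+; ∑-comm; sum-replicate-zero; *-distribˡ-sum)

-- Indicators, sums and counting

𝟙 : ∀ {p} {P : Set p} → Dec P → ℕ
𝟙 d = if does d then 1 else 0

module _ {p} {P : Set p} where

  𝟙-yes : (d : Dec P) → P → 𝟙 d ≡ 1
  𝟙-yes (yes _) _ = refl
  𝟙-yes (no ¬p) p = contradiction p ¬p

  𝟙-no : (d : Dec P) → ¬ P → 𝟙 d ≡ 0
  𝟙-no (yes p) ¬p = contradiction p ¬p
  𝟙-no (no _)  _  = refl

  𝟙≤1 : (d : Dec P) → 𝟙 d ℕ.≤ 1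
  𝟙≤1 (yes _) = ≤-refl
  𝟙≤1 (no _)  = z≤n

  𝟙≤ : (d : Dec P) {k : ℕ} → (P → 0 < k) → 𝟙 d ℕ.≤ k
  𝟙≤ (yes p) f = f p
  𝟙≤ (no _)  f = z≤n

𝟙-cong : ∀ {p q} {P : Set p} {Q : Set q} (d : Dec P) (e : Dec Q) → (P → Q) → (Q → P) → 𝟙 d ≡ 𝟙 e
𝟙-cong (yes p) e P⇒Q _   = sym (𝟙-yes e (P⇒Q p))
𝟙-cong (no ¬p) e _   Q⇒P = sym (𝟙-no e (¬p ∘ Q⇒P))

𝟙-disjoint : ∀ {p q} {P : Set p} {Q : Set q} (d : Dec P) (e : Dec Q) → (P → ¬ Q) → 𝟙 d + 𝟙 e ℕ.≤ 1
𝟙-disjoint (yes p) e P⇒¬Q = ≤-reflexive (cong suc (𝟙-no e (P⇒¬Q p)))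
𝟙-disjoint (no _)  e _    = 𝟙≤1 e

𝟙-≡1-* : ∀ {k} (d : Dec (k ≡ 1)) → 𝟙 d * k ≡ 𝟙 d
𝟙-≡1-* (yes refl) = refl
𝟙-≡1-* (no _)     = refl

sum-mono-≤ : ∀ {n} {f g : Fin n → ℕ} → (∀ i → f i ℕ.≤ g i) → sum f ℕ.≤ sum g
sum-mono-≤ {zero}  f≤g = z≤n
sum-mono-≤ {suc n} f≤g = +-mono-≤ (f≤g zero) (sum-mono-≤ (f≤g ∘ suc))

term≤sum : ∀ {n} (f : Fin n → ℕ) i → f i ℕ.≤ sum f
term≤sum f zero    = m≤m+n _ _
term≤sum f (suc i) = ≤-trans (term≤sum (f ∘ suc) i) (m≤n+m _ _)

terms≤sum : ∀ {n} (f : Fin n → ℕ) {i j} → i ≢ j → f i + f j ℕ.≤ sum f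
terms≤sum f {zero}  {zero}  i≢j = contradiction refl i≢j
terms≤sum f {zero}  {suc j} i≢j = +-monoʳ-≤ (f zero) (term≤sum (f ∘ suc) j)
terms≤sum f {suc i} {zero}  i≢j = ≤-trans (≤-reflexive (+-comm _ (f zero))) (+-monoʳ-≤ (f zero) (term≤sum (f ∘ suc) i))
terms≤sum f {suc i} {suc j} i≢j = ≤-trans (terms≤sum (f ∘ suc) (i≢j ∘ cong suc)) (m≤n+m _ _)

-- A strict inequality at one index could not be made up for at another.
sum-≥⇒≡ : ∀ {n} {f g : Fin n → ℕ} → (∀ i → f i ℕ.≤ g i) → sum g ℕ.≤ sum f → ∀ i → f i ≡ g i
sum-≥⇒≡ {suc n} {f} {g} f≤g Σg≤Σf zero =
  ≤-antisym (f≤g zero) (+-cancelʳ-≤ (sum (f ∘ suc)) _ _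
    (≤-trans (+-monoʳ-≤ (g zero) (sum-mono-≤ (f≤g ∘ suc))) Σg≤Σf))
sum-≥⇒≡ {suc n} {f} {g} f≤g Σg≤Σf (suc i) =
  sum-≥⇒≡ (f≤g ∘ suc) (+-cancelˡ-≤ (f zero) _ _ (≤-trans (+-monoˡ-≤ _ (f≤g zero)) Σg≤Σf)) i

sum-ones : ∀ n → ∑[ i < n ] 1 ≡ n
sum-ones zero    = refl
sum-ones (suc n) = cong suc (sum-ones n)

δ : ∀ {n} → Fin n → Fin n → ℕ
δ i j = 𝟙 (i Fin.≟ j)

δ-refl : ∀ {n} (i : Fin n) → δ i i ≡ 1
δ-refl i = 𝟙-yes (i Fin.≟ i) refl

δ-≢ : ∀ {n} {i j : Fin n} → i ≢ j → δ i j ≡ 0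
δ-≢ = 𝟙-no (_ Fin.≟ _)

δ-suc : ∀ {n} (i j : Fin n) → δ (suc i) (suc j) ≡ δ i j
δ-suc i j with i Fin.≟ j
... | yes _ = refl
... | no _  = refl

sum-δ : ∀ {n} (i : Fin n) → ∑[ j < n ] δ j i ≡ 1
sum-δ {suc n} zero    = cong suc (sum-replicate-zero n)
sum-δ {suc n} (suc i) = trans (sum-cong-≗ (λ j → δ-suc j i)) (sum-δ i)

module _ {a p} {A : Set a} {P : Pred A p} (P? : Decidable P) where

  count-tabulate : ∀ {n} (f : Fin n → A) → length (filter P? (tabulate f)) ≡ ∑[ i < n ] 𝟙 (P? (f i))
  count-tabulate {zero}  f = refl
  count-tabulate {suc n} f with does (P? (f zero))
  ... | true  = cong suc (count-tabulate (f ∘ suc))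
  ... | false = count-tabulate (f ∘ suc)

count-map-allFin : ∀ {a p n} {A : Set a} {P : Pred A p} (P? : Decidable P) (f : Fin n → A) →
  length (filter P? (map f (allFin n))) ≡ ∑[ i < n ] 𝟙 (P? (f i))
count-map-allFin P? f = trans (cong (length ∘ filter P?) (map-tabulate id f)) (count-tabulate P? f)

-- The first factor is a general `tabulate f`, because the induction strips its head.
count-product : ∀ {p m n} {P : Pred (Fin m × Fin n) p} (P? : Decidable P) {k} (f : Fin k → Fin m) →
  length (filter P? (cartesianProduct (tabulate f) (allFin n))) ≡ ∑[ i < k ] ∑[ j < n ] 𝟙 (P? (f i , j))
count-product P? {zero}  f = refl
count-product {n = n} P? {suc k} f = begin
  length (filter P? (row ++ rest))                   ≡⟨ cong length (filter-++ P? row rest) ⟩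
  length (filter P? row ++ filter P? rest)           ≡⟨ length-++ (filter P? row) ⟩
  length (filter P? row) + length (filter P? rest)   ≡⟨ cong₂ _+_ (count-map-allFin P? (f zero ,_)) (count-product P? (f ∘ suc)) ⟩
  _                                                  ∎
  where
  open ≡-Reasoning
  row  = map (f zero ,_) (allFin n)
  rest = cartesianProduct (tabulate (f ∘ suc)) (allFin n)

-- Walks

module _ {n : ℕ} where

  private
    V = Fin n

  occurrences : V → List V → ℕ
  occurrences v []       = 0
  occurrences v (x ∷ xs) = δ v x + occurrences v xs

  steps : V → V → List V → ℕ
  steps v w (x ∷ y ∷ zs) = δ v x * δ w y + steps v w (y ∷ zs)
  steps v w _            = 0

  -- The adjacency matrix of the walk as an undirected multigraph, in a form that can be subtracted
  -- entrywise from that of a graph.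
  traversals : List V → V → V → ℕ
  traversals xs v w = steps v w xs + steps w v xs

  occurrences-∷ʳ : ∀ v xs x → occurrences v (xs ∷ʳ x) ≡ δ v x + occurrences v xs
  occurrences-∷ʳ v []       x = refl
  occurrences-∷ʳ v (y ∷ ys) x = begin
    δ v y + occurrences v (ys ∷ʳ x)      ≡⟨ cong (δ v y +_) (occurrences-∷ʳ v ys x) ⟩
    δ v y + (δ v x + occurrences v ys)   ≡⟨ x∙yz≈y∙xz (δ v y) (δ v x) _ ⟩
    δ v x + (δ v y + occurrences v ys)   ∎
    where
    open ≡-Reasoning
    open import Algebra.Properties.CommutativeSemigroup +-commutativeSemigroup using (x∙yz≈y∙xz)

  sum-occurrences : ∀ xs → ∑[ v < n ] occurrences v xs ≡ length xs
  sum-occurrences []       = sum-replicate-zero n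
  sum-occurrences (x ∷ xs) = trans (∑-distrib-+ (λ v → δ v x) _) (cong₂ _+_ (sum-δ x) (sum-occurrences xs))

  private
    sum-*-δ : ∀ k y → ∑[ w < n ] (k * δ w y) ≡ k
    sum-*-δ k y = trans (sym (*-distribˡ-sum k (λ w → δ w y))) (trans (cong (k *_) (sum-δ y)) (*-identityʳ k))

  -- Every entry but the last is followed by exactly one entry; dually, for `sum-steps-to`, every
  -- entry but the first is preceded by exactly one.
  sum-steps-from : ∀ v xs x → ∑[ w < n ] steps v w (xs ∷ʳ x) ≡ occurrences v xs
  sum-steps-from v []           x = sum-replicate-zero n
  sum-steps-from v (y ∷ [])     x =
    trans (∑-distrib-+ (λ w → δ v y * δ w x) _) (cong₂ _+_ (sum-*-δ (δ v y) x) (sum-replicate-zero n))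
  sum-steps-from v (y ∷ z ∷ zs) x =
    trans (∑-distrib-+ (λ w → δ v y * δ w z) _) (cong₂ _+_ (sum-*-δ (δ v y) z) (sum-steps-from v (z ∷ zs) x))

  sum-steps-to : ∀ v x xs → ∑[ w < n ] steps w v (x ∷ xs) ≡ occurrences v xs
  sum-steps-to v x []       = sum-replicate-zero n
  sum-steps-to v x (y ∷ ys) =
    trans (∑-distrib-+ (λ w → δ w x * δ v y) _)
          (cong₂ _+_ (trans (sum-cong-≗ (λ w → *-comm (δ w x) (δ v y))) (sum-*-δ (δ v y) x)) (sum-steps-to v y ys))

  -- A closed walk leaves v as often as it enters v.
  sum-traversals : ∀ v x xs → sum (traversals (x ∷ xs ∷ʳ x) v) ≡ 2 * occurrences v (x ∷ xs)
  sum-traversals v x xs = begin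
    ∑[ w < n ] (steps v w cw + steps w v cw)                 ≡⟨ ∑-distrib-+ (λ w → steps v w cw) _ ⟩
    ∑[ w < n ] steps v w cw + ∑[ w < n ] steps w v cw        ≡⟨ cong₂ _+_ (sum-steps-from v (x ∷ xs) x) (sum-steps-to v x (xs ∷ʳ x)) ⟩
    occurrences v (x ∷ xs) + occurrences v (xs ∷ʳ x)         ≡⟨ cong (occurrences v (x ∷ xs) +_) (occurrences-∷ʳ v xs x) ⟩
    occurrences v (x ∷ xs) + occurrences v (x ∷ xs)          ≡⟨ cong (occurrences v (x ∷ xs) +_) (sym (+-identityʳ _)) ⟩
    2 * occurrences v (x ∷ xs)                               ∎
    where
    open ≡-Reasoning
    cw = x ∷ xs ∷ʳ x

  -- Each step of the closed walk is counted in the rows of both its ends.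
  total-traversals : ∀ x xs → ∑[ v < n ] sum (traversals (x ∷ xs ∷ʳ x) v) ≡ 2 * length (x ∷ xs)
  total-traversals x xs = begin
    ∑[ v < n ] sum (traversals (x ∷ xs ∷ʳ x) v)   ≡⟨ sum-cong-≗ (λ v → sum-traversals v x xs) ⟩
    ∑[ v < n ] (2 * occurrences v (x ∷ xs))         ≡⟨ sym (*-distribˡ-sum 2 (λ v → occurrences v (x ∷ xs))) ⟩
    2 * ∑[ v < n ] occurrences v (x ∷ xs)         ≡⟨ cong (2 *_) (sum-occurrences (x ∷ xs)) ⟩
    2 * length (x ∷ xs)                           ∎
    where open ≡-Reasoning

  step-≢ : ∀ {v w x y : V} → ¬ (v ≡ x × w ≡ y) → δ v x * δ w y ≡ 0
  step-≢ {v} {w} {x} {y} ¬eq with v Fin.≟ x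
  ... | no _    = refl
  ... | yes v≡x = trans (+-identityʳ (δ w y)) (δ-≢ (λ w≡y → ¬eq (v≡x , w≡y)))

  steps-pos⇒consecutive : ∀ v w x xs → 0 < steps v w (x ∷ xs) → Consecutive v w (x ∷ xs)
  steps-pos⇒consecutive v w x (y ∷ ys) pos with v Fin.≟ x | w Fin.≟ y
  ... | yes refl | yes refl = here
  ... | yes _    | no _     = there (steps-pos⇒consecutive v w y ys pos)
  ... | no _     | _        = there (steps-pos⇒consecutive v w y ys pos)

  traversals-pos⇒consecutive : ∀ x xs v w → 0 < traversals (x ∷ xs) v w →
    Consecutive v w (x ∷ xs) ⊎ Consecutive w v (x ∷ xs)
  traversals-pos⇒consecutive x xs v w pos with steps v w (x ∷ xs) in eq
  ... | zero  = inj₂ (steps-pos⇒consecutive w v x xs pos)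
  ... | suc _ = inj₁ (steps-pos⇒consecutive v w x xs (subst (0 <_) (sym eq) (s≤s z≤n)))

  traversals-sym : ∀ xs v w → traversals xs v w ≡ traversals xs w v
  traversals-sym xs v w = +-comm (steps v w xs) (steps w v xs)

  steps-from-∉ : ∀ {v} w xs → All (v ≢_) xs → steps v w xs ≡ 0
  steps-from-∉ w []           _         = refl
  steps-from-∉ w (_ ∷ [])     _         = refl
  steps-from-∉ w (x ∷ y ∷ zs) (v≢x ∷ ps) rewrite δ-≢ v≢x = steps-from-∉ w (y ∷ zs) ps

  steps-to-∉ : ∀ {v} w x xs → All (v ≢_) xs → steps w v (x ∷ xs) ≡ 0
  steps-to-∉ w x []       _          = refl
  steps-to-∉ w x (y ∷ ys) (v≢y ∷ ps) rewrite δ-≢ v≢y | *-zeroʳ (δ w x) = steps-to-∉ w y ys ps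

  traversals-first : ∀ x y zs → x ≢ y → traversals (y ∷ zs) x y ≡ 0 → traversals (x ∷ y ∷ zs) x y ≡ 1
  traversals-first x y zs x≢y rest≡0 = begin
    (δ x x * δ y y + steps x y (y ∷ zs)) + (δ y x * δ x y + steps y x (y ∷ zs))
      ≡⟨ cong₂ _+_ (cong (_+ steps x y (y ∷ zs)) (cong₂ _*_ (δ-refl x) (δ-refl y)))
                   (cong (λ k → k * δ x y + steps y x (y ∷ zs)) (δ-≢ (≢-sym x≢y))) ⟩
    1 + traversals (y ∷ zs) x y   ≡⟨ cong suc rest≡0 ⟩
    1                             ∎
    where open ≡-Reasoning

  -- Prefixing `x` changes only the entries for the pair `x`, `y` in either order, and these are
  -- zero in the tail by assumption.
  traversals-∷-≤1 : ∀ x y zs → x ≢ y → traversals (y ∷ zs) x y ≡ 0 →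
    (∀ v w → traversals (y ∷ zs) v w ℕ.≤ 1) → ∀ v w → traversals (x ∷ y ∷ zs) v w ℕ.≤ 1
  traversals-∷-≤1 x y zs x≢y rest≡0 rest≤1 v w = split ((v Fin.≟ x) ×-dec (w Fin.≟ y)) ((w Fin.≟ x) ×-dec (v Fin.≟ y))
    where
    open ≤-Reasoning
    split : Dec (v ≡ x × w ≡ y) → Dec (w ≡ x × v ≡ y) → traversals (x ∷ y ∷ zs) v w ℕ.≤ 1
    split (yes (refl , refl)) _                   = ≤-reflexive (traversals-first x y zs x≢y rest≡0)
    split (no _)              (yes (refl , refl)) =
      ≤-reflexive (trans (traversals-sym (x ∷ y ∷ zs) y x) (traversals-first x y zs x≢y rest≡0))
    split (no ¬vw)            (no ¬wv)            = begin
      (δ v x * δ w y + steps v w (y ∷ zs)) + (δ w x * δ v y + steps w v (y ∷ zs))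
        ≡⟨ cong₂ _+_ (cong (_+ steps v w (y ∷ zs)) (step-≢ ¬vw)) (cong (_+ steps w v (y ∷ zs)) (step-≢ ¬wv)) ⟩
      traversals (y ∷ zs) v w   ≤⟨ rest≤1 v w ⟩
      1                         ∎

  unique⇒traversals≤1 : ∀ xs → Unique xs → ∀ v w → traversals xs v w ℕ.≤ 1
  unique⇒traversals≤1 []           _ v w = z≤n
  unique⇒traversals≤1 (_ ∷ [])     _ v w = z≤n
  unique⇒traversals≤1 (x ∷ y ∷ zs) ((x≢y ∷ x∉zs) ∷ uniq) =
    traversals-∷-≤1 x y zs x≢y
      (cong₂ _+_ (steps-from-∉ y (y ∷ zs) (x≢y ∷ x∉zs)) (steps-to-∉ y y zs x∉zs))
      (unique⇒traversals≤1 (y ∷ zs) uniq)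

  unique-rotate : ∀ {x : V} {xs} → Unique (x ∷ xs) → Unique (xs ∷ʳ x)
  unique-rotate (x∉xs ∷ uniq) =
    Unique.++⁺ uniq ([] ∷ []) λ where (v∈xs , here refl) → All.lookup x∉xs v∈xs refl

  -- Without its first step the closed walk is a rotation of the cycle, hence free of repetitions.
  -- There `y` comes only first and `x` only last, with `z` between them, so the step from `x` to
  -- `y` is not repeated. Length 3 matters: a closed walk of length 2 uses its edge twice.
  closed⇒traversals≤1 : ∀ x xs → 3 ℕ.≤ length (x ∷ xs) → Unique (x ∷ xs) → ∀ v w → traversals (x ∷ xs ∷ʳ x) v w ℕ.≤ 1
  closed⇒traversals≤1 x (y ∷ z ∷ zs) _ uniq@((x≢y ∷ x≢z ∷ _) ∷ _) with unique-rotate uniq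
  ... | uniq′@(y∉ ∷ _) =
    traversals-∷-≤1 x y (z ∷ zs ∷ʳ x) x≢y
      (cong₂ _+_
        (cong₂ _+_ (cong (_* δ y z) (δ-≢ x≢y)) (steps-to-∉ x z (zs ∷ʳ x) (All.tail y∉)))
        (cong₂ _+_ (trans (cong (δ y y *_) (δ-≢ x≢z)) (*-zeroʳ (δ y y))) (steps-from-∉ x (z ∷ zs ∷ʳ x) y∉)))
      (unique⇒traversals≤1 _ uniq′)
  closed⇒traversals≤1 x (_ ∷ []) (s≤s (s≤s ()))
  closed⇒traversals≤1 x []       (s≤s ())

module _ {A : Set} where

  -- The list index omits the first vertex, so that `u ∷ vs` matches `start ∷ others` of a `Cycle`.
  data Path (R : Rel A 0ℓ) : A → A → List A → Set where
    []  : ∀ {u} → Path R u u []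
    _∷_ : ∀ {u v w vs} → R u v → Path R v w vs → Path R u w (v ∷ vs)

  module _ {R : Rel A 0ℓ} where

    path-suffix : ∀ {u v vs z} → Path R u v vs → Unique (u ∷ vs) → z ∈ u ∷ vs →
      ∃[ zs ] Path R z v zs × Unique (z ∷ zs)
    path-suffix p       uniq       (here refl) = _ , p , uniq
    path-suffix (_ ∷ p) (_ ∷ uniq) (there z∈)  = path-suffix p uniq z∈

    closePath : ∀ {S : Rel A 0ℓ} {u v vs z} → R ⇒ S → Path R u v vs → S v z → Linked S (u ∷ vs ∷ʳ z)
    closePath R⇒S []      vz = vz ∷ [-]
    closePath R⇒S (r ∷ p) vz = R⇒S r ∷ closePath R⇒S p vz

    closing-step : ∀ {u v vs} z → Path R u v vs → Consecutive v z (u ∷ vs ∷ʳ z)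
    closing-step z []      = here
    closing-step z (_ ∷ p) = there (closing-step z p)

  linked-consecutive : ∀ {R : Rel A 0ℓ} {xs u v} → Linked R xs → Consecutive u v xs → R u v
  linked-consecutive (r ∷ _)  here      = r
  linked-consecutive (_ ∷ rs) (there c) = linked-consecutive rs c

-- Loop erasure: if the new first vertex already lies on the simple path built so far, everything
-- before that occurrence is discarded.
simplePath : ∀ {n} {R : Rel (Fin n) 0ℓ} {u v} → Star R u v → ∃[ vs ] Path R u v vs × Unique (u ∷ vs)
simplePath ε = [] , [] , [] ∷ []
simplePath {n} {R} {u} (_◅_ {j = z} r s) with simplePath s
... | zs , p , uniq with _∈?_ Fin._≟_ u (z ∷ zs)
...   | yes u∈ = path-suffix p uniq u∈
...   | no u∉  = z ∷ zs , r ∷ p , All.¬Any⇒All¬ _ u∉ ∷ uniq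

-- Components and cycles

module _ {n : ℕ} where

  private
    V = Fin n

  -- The union step of a union-find structure: the class represented by `a` passes to the
  -- representative `b`.
  relabel : V → V → (V → V) → V → V
  relabel a b f v with f v Fin.≟ a
  ... | yes _ = b
  ... | no  _ = f v

  relabel-≡ : ∀ {a b v} f → f v ≡ a → relabel a b f v ≡ b
  relabel-≡ {a} {v = v} f fv≡a with f v Fin.≟ a
  ... | yes _   = refl
  ... | no fv≢a = contradiction fv≡a fv≢a

  -- For an idempotent `f` the fixed points are exactly its values, so this counts the labels in
  -- use.
  fixedPoints : (V → V) → ℕ
  fixedPoints f = ∑[ v < n ] δ v (f v)

  module _ {f : V → V} (idem : ∀ v → f (f v) ≡ f v) {x y : V} (fx≢fy : f x ≢ f y) where

    relabel-idem : ∀ v → relabel (f x) (f y) f (relabel (f x) (f y) f v) ≡ relabel (f x) (f y) f v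
    relabel-idem v with f v Fin.≟ f x
    ... | yes _ with f (f y) Fin.≟ f x
    ...   | yes _ = refl
    ...   | no _  = idem y
    relabel-idem v | no fv≢fx with f (f v) Fin.≟ f x
    ...   | yes ffv≡fx = contradiction (trans (sym (idem v)) ffv≡fx) fv≢fx
    ...   | no _       = idem v

    private
      -- The fixed point `f x` is lost, being sent to `f y` now. None is gained: a vertex newly sent
      -- to `f y` is fixed only if it is `f y`, which `f` fixes already.
      loses-fx : ∀ v → δ v (relabel (f x) (f y) f v) + δ v (f x) ℕ.≤ δ v (f v)
      loses-fx v with v Fin.≟ f x
      ... | yes refl = ≤-reflexive (trans
        (cong (_+ 1) (trans (cong (δ (f x)) (relabel-≡ f (idem x))) (δ-≢ fx≢fy)))
        (sym (𝟙-yes (f x Fin.≟ f (f x)) (sym (idem x)))))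
      loses-fx v | no v≢fx rewrite +-identityʳ (δ v (relabel (f x) (f y) f v)) with f v Fin.≟ f x
      ...   | no _    = ≤-refl
      ...   | yes _   = 𝟙≤ (v Fin.≟ f y) λ { refl → ≤-reflexive (sym (𝟙-yes (f y Fin.≟ f (f y)) (sym (idem y)))) }

    relabel-fixedPoints : fixedPoints (relabel (f x) (f y) f) + 1 ℕ.≤ fixedPoints f
    relabel-fixedPoints = begin
      fixedPoints (relabel (f x) (f y) f) + 1                                ≡⟨ cong (fixedPoints (relabel (f x) (f y) f) +_) (sym (sum-δ (f x))) ⟩
      fixedPoints (relabel (f x) (f y) f) + ∑[ v < n ] δ v (f x)             ≡⟨ sym (∑-distrib-+ (λ v → δ v (relabel (f x) (f y) f v)) _) ⟩
      ∑[ v < n ] (δ v (relabel (f x) (f y) f v) + δ v (f x))                 ≤⟨ sum-mono-≤ loses-fx ⟩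
      fixedPoints f                                                          ∎
      where open ≤-Reasoning

  Joined : List (V × V) → Rel V 0ℓ
  Joined L u v = (u , v) ∈ L ⊎ (v , u) ∈ L

  joined-there : ∀ {L e} → Joined L ⇒ Joined (e ∷ L)
  joined-there = Sum.map there there

  -- If just one of the two vertices changed its label, the walk passes between the classes of `x`
  -- and `y` over the new edge.
  relabel-connected : ∀ {L x y} {f : V → V} → (∀ {u v} → f u ≡ f v → Star (Joined L) u v) →
    ∀ {u v} → relabel (f x) (f y) f u ≡ relabel (f x) (f y) f v → Star (Joined ((x , y) ∷ L)) u v
  relabel-connected {x = x} {f = f} conn {u} {v} eq with f u Fin.≟ f x | f v Fin.≟ f x
  ... | yes u-x | yes v-x = Star.map joined-there (conn (trans u-x (sym v-x)))
  ... | yes u-x | no _    = Star.map joined-there (conn u-x) ◅◅ inj₁ (here refl) ◅ Star.map joined-there (conn eq)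
  ... | no _    | yes v-x = Star.map joined-there (conn eq) ◅◅ inj₂ (here refl) ◅ Star.map joined-there (conn (sym v-x))
  ... | no _    | no _    = Star.map joined-there (conn eq)

module _ {n : ℕ} (G : SimpleGraph n) where
  open SimpleGraph G renaming (sym to ~-sym)

  private
    V = Fin n

  adj : V → V → ℕ
  adj v w = 𝟙 (v ~? w)

  adj-sym : ∀ v w → adj v w ≡ adj w v
  adj-sym v w = 𝟙-cong (v ~? w) (w ~? v) ~-sym ~-sym

  Edge : V × V → Set
  Edge (x , y) = x Fin.< y × x ~ y

  joined⇒adjacent : ∀ {L u v} → All Edge L → Joined L u v → u ~ v
  joined⇒adjacent edges (inj₁ e) = proj₂ (All.lookup edges e)
  joined⇒adjacent edges (inj₂ e) = ~-sym (proj₂ (All.lookup edges e))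

  -- Uniqueness excludes the pair itself from `L`; the reversed pair is excluded because listed
  -- pairs are increasing.
  edge-fresh : ∀ {L x y} → All Edge ((x , y) ∷ L) → Unique ((x , y) ∷ L) → ¬ Joined L x y
  edge-fresh _                   (e∉ ∷ _) (inj₁ e) = All.lookup e∉ e refl
  edge-fresh ((x<y , _) ∷ edges) _        (inj₂ e) = Fin.<-asym x<y (proj₁ (All.lookup edges e))

  CycleIn : List (V × V) → Cycle G → Set
  CycleIn L C = Linked (Joined L) (Cycle.closedWalk C)

  edgeOf-in : ∀ {L C u v} → CycleIn L C → EdgeOf G C u v → Joined L u v
  edgeOf-in C⊆L = [ linked-consecutive C⊆L , Sum.swap ∘ linked-consecutive C⊆L ]′

  edgeOf⇒adjacent : ∀ C {u v} → EdgeOf G C u v → u ~ v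
  edgeOf⇒adjacent C = [ linked-consecutive linked , ~-sym ∘ linked-consecutive linked ]′
    where open Cycle C

  -- Both `x` and `z` lie on the side opposite to `y`.
  no-triangle : Bipartite G → ∀ {x y z} → x ~ y → y ~ z → ¬ x ~ z
  no-triangle (side , proper) {x} {y} {z} xy yz xz =
    proper x z xz (trans (Bool.¬-not (proper x y xy)) (sym (Bool.¬-not (≢-sym (proper y z yz)))))

  -- The new edge closes a simple path of older edges. That path has at least three steps:
  -- irreflexivity excludes none, freshness of the edge excludes one, and bipartiteness excludes
  -- two.
  closingCycle : Bipartite G → ∀ {L x y} → All Edge ((x , y) ∷ L) → ¬ Joined L x y → Star (Joined L) x y →
    Σ[ C ∈ Cycle G ] 4 ℕ.≤ length (Cycle.vertices C) × EdgeOf G C x y × CycleIn ((x , y) ∷ L) C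
  closingCycle bip {L} {x} {y} ((_ , xy) ∷ edges) fresh s with simplePath s
  ... | vs , p , uniq = C , four p , inj₂ (closing-step x p) , closePath joined-there p (inj₂ (here refl))
    where
    four : ∀ {vs} → Path (Joined L) x y vs → 4 ℕ.≤ length (x ∷ vs)
    four []                  = contradiction xy (irrefl refl)
    four (r ∷ [])            = contradiction r fresh
    four (r ∷ r′ ∷ [])       =
      contradiction xy (no-triangle bip (joined⇒adjacent edges r) (joined⇒adjacent edges r′))
    four (_ ∷ _ ∷ _ ∷ p)     = s≤s (s≤s (s≤s (s≤s z≤n)))
    C : Cycle G
    C = record
      { start  = x
      ; others = vs
      ; long   = ≤-trans (n≤1+n 3) (four p)
      ; unique = uniq
      ; linked = closePath (joined⇒adjacent edges) p (~-sym xy)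
      }

  total : (V → V → ℕ) → ℕ
  total f = ∑[ v < n ] sum (f v)

  -- The labels name the connected components of the graph with edge list L, and
  -- rest is the adjacency matrix of G without the cycles closed so far.
  record Decomposition (L : List (V × V)) : Set where
    field
      label           : V → V
      label-idem      : ∀ v → label (label v) ≡ label v
      label-connected : ∀ {u v} → label u ≡ label v → Star (Joined L) u v
      cycles          : ℕ
      edges≤          : length L + fixedPoints label ℕ.≤ n + cycles
      rest            : V → V → ℕ
      rest≤adj        : ∀ v w → rest v w ℕ.≤ adj v w
      rest-sym        : ∀ v w → rest v w ≡ rest w v
      rest-parity     : ∀ v → ∃[ k ] sum (rest v) + 2 * k ≡ sum (adj v)
      -- A closed cycle has at least 4 edges, each counted from both ends, whence 8.
      rest-total      : total rest + 8 * cycles ℕ.≤ total adj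
      rest-cycle      : ∀ {v w} → v ~ w → rest v w ≡ 0 → Σ[ C ∈ Cycle G ] EdgeOf G C v w × CycleIn L C

  module _ (cactus : IsCactus G) (bip : Bipartite G) where
    open IsCactus cactus

    emptyDecomposition : Decomposition []
    emptyDecomposition = record
      { label           = id
      ; label-idem      = λ _ → refl
      ; label-connected = λ { refl → ε }
      ; cycles          = 0
      ; edges≤          = ≤-trans (≤-reflexive (trans (sum-cong-≗ {n} δ-refl) (sum-ones n))) (m≤m+n n 0)
      ; rest            = adj
      ; rest≤adj        = λ _ _ → ≤-refl
      ; rest-sym        = adj-sym
      ; rest-parity     = λ v → 0 , +-identityʳ _
      ; rest-total      = ≤-reflexive (+-identityʳ _)
      ; rest-cycle      = λ {v} {w} vw eq → contradiction (trans (sym (𝟙-yes (v ~? w) vw)) eq) λ ()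
      }

    module _ {L : List (V × V)} {x y : V} (D : Decomposition L) where
      open Decomposition D

      -- One more edge is listed and at least one label disappears, so the left side of `edges≤`
      -- does not grow; cycles and `rest` are kept.
      joinComponents : label x ≢ label y → Decomposition ((x , y) ∷ L)
      joinComponents lx≢ly = record
        { Decomposition D
        ; label           = relabel (label x) (label y) label
        ; label-idem      = relabel-idem label-idem lx≢ly
        ; label-connected = relabel-connected label-connected
        ; edges≤          = ≤-trans (≤-reflexive reorder)
                              (≤-trans (+-monoʳ-≤ (length L) (relabel-fixedPoints label-idem lx≢ly)) edges≤)
        ; rest-cycle      = λ vw eq → let (C , e , C⊆L) = rest-cycle vw eq in C , e , Linked.map joined-there C⊆L
        }
        where
        reorder : suc (length L) + fixedPoints (relabel (label x) (label y) label)
                ≡ length L + (fixedPoints (relabel (label x) (label y) label) + 1)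
        reorder = solve 2 (λ l f → con 1 :+ l :+ f := l :+ (f :+ con 1)) refl (length L) _
          where open +-*-Solver

      -- The new edge and the new cycle add one to either side of `edges≤`. The edges of `C` are
      -- taken out of `rest`, and `used≤rest` makes the truncated subtraction exact.
      removeCycle : ¬ Joined L x y → (C : Cycle G) → 4 ℕ.≤ length (Cycle.vertices C) → EdgeOf G C x y →
        CycleIn ((x , y) ∷ L) C → Decomposition ((x , y) ∷ L)
      removeCycle fresh C 4≤ xy∈C C⊆L = record
        { label           = label
        ; label-idem      = label-idem
        ; label-connected = Star.map joined-there ∘ label-connected
        ; cycles          = suc cycles
        ; edges≤          = ≤-trans (s≤s edges≤) (≤-reflexive (sym (+-suc n cycles)))
        ; rest            = rest′
        ; rest≤adj        = λ v w → ≤-trans (m∸n≤m (rest v w) (used v w)) (rest≤adj v w)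
        ; rest-sym        = λ v w → cong₂ _∸_ (rest-sym v w) (traversals-sym closedWalk v w)
        ; rest-parity     = parity
        ; rest-total      = total-bound
        ; rest-cycle      = removed-on-cycle
        }
        where
        open Cycle C

        used rest′ : V → V → ℕ
        used = traversals closedWalk
        rest′ v w = rest v w ∸ used v w

        used⇒edge : ∀ v w → 0 < used v w → EdgeOf G C v w
        used⇒edge = traversals-pos⇒consecutive start (others ∷ʳ start)

        -- An edge of C no longer in rest lies on a cycle within L, which is then the
        -- same cycle as C; but C contains the new edge.
        used≤rest : ∀ v w → used v w ℕ.≤ rest v w
        used≤rest v w with rest v w in rest≡
        ... | suc _ = ≤-trans (closed⇒traversals≤1 start others long unique v w) (s≤s z≤n)
        ... | zero  = ≮⇒≥ λ pos →
          let vw∈C           = used⇒edge v w pos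
              vw             = edgeOf⇒adjacent C vw∈C
              (D , vw∈D , D⊆L) = rest-cycle vw rest≡
          in fresh (edgeOf-in {C = D} D⊆L (Equivalence.to (edgeInAtMostOneCycle vw C D vw∈C vw∈D x y) xy∈C))

        rest-split : ∀ v → sum (rest′ v) + sum (used v) ≡ sum (rest v)
        rest-split v = trans (sym (∑-distrib-+ (rest′ v) (used v))) (sum-cong-≗ (λ w → m∸n+n≡m (used≤rest v w)))

        parity : ∀ v → ∃[ k ] sum (rest′ v) + 2 * k ≡ sum (adj v)
        parity v with rest-parity v
        -- Each visit of the cycle to `v` takes two from the row of `v`.
        ... | k , eq = occurrences v vertices + k , (begin
          sum (rest′ v) + 2 * (occurrences v vertices + k)
            ≡⟨ solve 3 (λ r o k → r :+ con 2 :* (o :+ k) := r :+ con 2 :* o :+ con 2 :* k) refl (sum (rest′ v)) (occurrences v vertices) k ⟩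
          sum (rest′ v) + 2 * occurrences v vertices + 2 * k
            ≡⟨ cong (λ s → sum (rest′ v) + s + 2 * k) (sym (sum-traversals v start others)) ⟩
          sum (rest′ v) + sum (used v) + 2 * k
            ≡⟨ cong (_+ 2 * k) (rest-split v) ⟩
          sum (rest v) + 2 * k   ≡⟨ eq ⟩
          sum (adj v)            ∎)
          where
          open ≡-Reasoning
          open +-*-Solver

        total-bound : total rest′ + 8 * suc cycles ℕ.≤ total adj
        total-bound = begin
          total rest′ + 8 * suc cycles                  ≡⟨ cong (total rest′ +_) (*-suc 8 cycles) ⟩
          total rest′ + (2 * 4 + 8 * cycles)            ≤⟨ +-monoʳ-≤ (total rest′) (+-monoˡ-≤ (8 * cycles) (*-monoʳ-≤ 2 4≤)) ⟩
          total rest′ + (2 * length vertices + 8 * cycles)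
            ≡⟨ cong (λ t → total rest′ + (t + 8 * cycles)) (sym (total-traversals start others)) ⟩
          total rest′ + (total used + 8 * cycles)       ≡⟨ sym (+-assoc (total rest′) _ _) ⟩
          total rest′ + total used + 8 * cycles         ≡⟨ cong (_+ 8 * cycles) (trans (sym (∑-distrib-+ (λ v → sum (rest′ v)) _)) (sum-cong-≗ rest-split)) ⟩
          total rest + 8 * cycles                       ≤⟨ rest-total ⟩
          total adj                                     ∎
          where open ≤-Reasoning hiding (start)

        removed-on-cycle : ∀ {v w} → v ~ w → rest′ v w ≡ 0 → Σ[ C ∈ Cycle G ] EdgeOf G C v w × CycleIn ((x , y) ∷ L) C
        removed-on-cycle {v} {w} vw eq with used v w in used≡
        -- Either `C` itself uses the edge, or the entry was zero before `C` was removed.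
        ... | suc _ = C , used⇒edge v w (subst (0 <_) (sym used≡) (s≤s z≤n)) , C⊆L
        ... | zero  = let (D , e , D⊆L) = rest-cycle vw eq in D , e , Linked.map joined-there D⊆L

    decompose : ∀ L → All Edge L → Unique L → Decomposition L
    decompose []            _                 _                 = emptyDecomposition
    decompose ((x , y) ∷ L) edges@(_ ∷ edges′) uniq@(_ ∷ uniq′) with decompose L edges′ uniq′
    ... | D with Decomposition.label D x Fin.≟ Decomposition.label D y
    ...   | no lx≢ly  = joinComponents D lx≢ly
    ...   | yes lx≡ly =
      let fresh                 = edge-fresh edges uniq
          (C , 4≤ , e , C⊆L) = closingCycle bip edges fresh (Decomposition.label-connected D lx≡ly)
      in removeCycle D fresh C 4≤ e C⊆L

-- Degrees

module _ {n : ℕ} (G : SimpleGraph n) where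
  open SimpleGraph G renaming (sym to ~-sym)

  degree-sum : ∀ v → degree G v ≡ sum (adj G v)
  degree-sum v = count-tabulate (v ~?_) id

  edge? : Decidable (Edge G)
  edge? e = (proj₁ e Fin.<? proj₂ e) ×-dec (proj₁ e ~? proj₂ e)

  -- The adjacency matrix is its strictly upper triangular part `up` plus the transpose of `up`, and
  -- `edgeCount` is the total of `up`.
  handshake : total G (adj G) ≡ 2 * edgeCount G
  handshake = begin
    total G (adj G)                              ≡⟨ sum-cong-≗ (λ v → trans (sum-cong-≗ (split v)) (∑-distrib-+ (up v) (λ w → up w v))) ⟩
    ∑[ v < n ] (sum (up v) + ∑[ w < n ] up w v)  ≡⟨ ∑-distrib-+ (λ v → sum (up v)) _ ⟩
    total G up + ∑[ v < n ] ∑[ w < n ] up w v    ≡⟨ cong (total G up +_) (∑-comm (λ v w → up w v)) ⟩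
    total G up + total G up                      ≡⟨ cong (total G up +_) (sym (+-identityʳ _)) ⟩
    2 * total G up                               ≡⟨ cong (2 *_) (sym (count-product edge? id)) ⟩
    2 * edgeCount G                              ∎
    where
    open ≡-Reasoning
    up : Fin n → Fin n → ℕ
    up v w = 𝟙 (edge? (v , w))

    split : ∀ v w → adj G v w ≡ up v w + up w v
    split v w with Fin.<-cmp v w
    ... | tri< v<w _ w≮v = trans (𝟙-cong (v ~? w) (edge? (v , w)) (v<w ,_) proj₂)
                                 (sym (trans (cong (up v w +_) (𝟙-no (edge? (w , v)) (w≮v ∘ proj₁))) (+-identityʳ _)))
    ... | tri≈ v≮w v≡w w≮v = trans (𝟙-no (v ~? w) (irrefl v≡w))
                                 (sym (cong₂ _+_ (𝟙-no (edge? (v , w)) (v≮w ∘ proj₁)) (𝟙-no (edge? (w , v)) (w≮v ∘ proj₁))))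
    ... | tri> v≮w _ w<v = trans (𝟙-cong (v ~? w) (edge? (w , v)) (λ vw → w<v , ~-sym vw) (~-sym ∘ proj₂))
                                 (sym (cong (_+ up w v) (𝟙-no (edge? (v , w)) (v≮w ∘ proj₁))))

  leaf-neighbour : ∀ {v w u} → degree G v ≡ 1 → v ~ w → v ~ u → u ≡ w
  leaf-neighbour {v} {w} {u} deg≡1 vw vu with u Fin.≟ w
  ... | yes u≡w = u≡w
  ... | no u≢w  = contradiction (begin
    2                       ≡⟨ sym (cong₂ _+_ (𝟙-yes (v ~? u) vu) (𝟙-yes (v ~? w) vw)) ⟩
    adj G v u + adj G v w   ≤⟨ terms≤sum (adj G v) u≢w ⟩
    sum (adj G v)           ≡⟨ sym (degree-sum v) ⟩
    degree G v              ≡⟨ deg≡1 ⟩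
    1                       ∎) 1+n≰n
    where open ≤-Reasoning

  -- Two adjacent leaves reach only each other, so a connected graph containing them has at most two
  -- vertices.
  leaves-nonadjacent : Connected G → 3 ℕ.≤ n → ∀ {v w} → degree G v ≡ 1 → degree G w ≡ 1 → ¬ v ~ w
  leaves-nonadjacent conn 3≤n {v} {w} dv dw vw = contradiction (≤-trans 3≤n n≤2) 1+n≰n
    where
    reach : ∀ {u z} → Star _~_ u z → u ≡ v ⊎ u ≡ w → z ≡ v ⊎ z ≡ w
    reach ε        u∈          = u∈
    reach (uz ◅ s) (inj₁ refl) = reach s (inj₂ (leaf-neighbour dv vw uz))
    reach (uz ◅ s) (inj₂ refl) = reach s (inj₁ (leaf-neighbour dw (~-sym vw) uz))

    covered : ∀ z → 1 ℕ.≤ δ z v + δ z w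
    covered z with reach (conn v z) (inj₁ refl)
    ... | inj₁ z≡v = ≤-trans (≤-reflexive (sym (𝟙-yes (z Fin.≟ v) z≡v))) (m≤m+n _ _)
    ... | inj₂ z≡w = ≤-trans (≤-reflexive (sym (𝟙-yes (z Fin.≟ w) z≡w))) (m≤n+m _ _)

    n≤2 : n ℕ.≤ 2
    n≤2 = begin
      n                                           ≡⟨ sym (sum-ones n) ⟩
      ∑[ z < n ] 1                                ≤⟨ sum-mono-≤ covered ⟩
      ∑[ z < n ] (δ z v + δ z w)                  ≡⟨ ∑-distrib-+ (λ z → δ z v) _ ⟩
      ∑[ z < n ] δ z v + ∑[ z < n ] δ z w         ≡⟨ cong₂ _+_ (sum-δ v) (sum-δ w) ⟩
      2                                           ∎
      where open ≤-Reasoning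

  edgeList : List (Fin n × Fin n)
  edgeList = filter edge? (cartesianProduct (allFin n) (allFin n))

  module _ (D : Decomposition G edgeList) where
    open Decomposition D

    -- Eight times `edges≤` is combined with `rest-total`, where the total of `adj` is `2 * m`. The
    -- vertex `v` guarantees a label in use, namely `label v`, which yields the 8 on the left and so
    -- the effect of `n - 1` without subtraction.
    edgeCount-bound : Fin n → total G rest + 6 * edgeCount G + 8 ℕ.≤ 8 * n
    edgeCount-bound v = +-cancelʳ-≤ (2 * m) _ _ (begin
      B + 6 * m + 8 + 2 * m              ≡⟨ solve 2 (λ B m → B :+ con 6 :* m :+ con 8 :+ con 2 :* m := B :+ con 8 :* (m :+ con 1)) refl B m ⟩
      B + 8 * (m + 1)                    ≤⟨ +-monoʳ-≤ B (*-monoʳ-≤ 8 (≤-trans (+-monoʳ-≤ m 1≤fixed) edges≤)) ⟩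
      B + 8 * (n + cycles)               ≡⟨ solve 3 (λ B n c → B :+ con 8 :* (n :+ c) := con 8 :* n :+ (B :+ con 8 :* c)) refl B n cycles ⟩
      8 * n + (B + 8 * cycles)           ≤⟨ +-monoʳ-≤ (8 * n) (≤-trans rest-total (≤-reflexive handshake)) ⟩
      8 * n + 2 * m                      ∎)
      where
      open ≤-Reasoning
      open +-*-Solver
      m = edgeCount G
      B = total G rest
      1≤fixed : 1 ℕ.≤ fixedPoints label
      1≤fixed = ≤-trans (≤-reflexive (sym (𝟙-yes (label v Fin.≟ label (label v)) (sym (label-idem v)))))
                        (term≤sum (λ u → δ u (label u)) (label v))

    -- If the row of `v` in `rest` is zero, parity makes the degree even and both indicators vanish.
    -- Otherwise it suffices that the two conditions exclude each other.
    odd-has-rest : ∀ v → 𝟙 (degree G v ≟ 1) + 𝟙 ((degree G v % 2 ≟ 1) ×-dec (1 <? degree G v)) ℕ.≤ sum (rest v)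
    odd-has-rest v with rest-parity v
    ... | k , parity with sum (rest v)
    ...   | zero  = ≤-reflexive (cong₂ _+_
                      (𝟙-no (degree G v ≟ 1) λ deg≡1 → not-odd (cong (_% 2) deg≡1))
                      (𝟙-no ((degree G v % 2 ≟ 1) ×-dec (1 <? degree G v)) (not-odd ∘ proj₁)))
      where
      deg≡ : degree G v ≡ k * 2
      deg≡ = trans (degree-sum v) (trans (sym parity) (*-comm 2 k))
      not-odd : degree G v % 2 ≢ 1
      not-odd odd = contradiction (trans (sym odd) (trans (cong (_% 2) deg≡) (m*n%n≡0 k 2))) λ ()
    ...   | suc s = ≤-trans
      (𝟙-disjoint (degree G v ≟ 1) ((degree G v % 2 ≟ 1) ×-dec (1 <? degree G v))
        λ deg≡1 odd>1 → <-irrefl (sym deg≡1) (proj₂ odd>1))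
      (s≤s z≤n)

    odd≤rest : μ₁ (degreeSequence G) + μodd (degreeSequence G) ℕ.≤ total G rest
    odd≤rest = begin
      μ₁ (degreeSequence G) + μodd (degreeSequence G)
        ≡⟨ cong₂ _+_ (count-map-allFin (_≟ 1) (degree G)) (count-map-allFin (λ k → (k % 2 ≟ 1) ×-dec (1 <? k)) (degree G)) ⟩
      _ ≡⟨ sym (∑-distrib-+ (λ v → 𝟙 (degree G v ≟ 1)) _) ⟩
      _ ≤⟨ sum-mono-≤ odd-has-rest ⟩
      total G rest ∎
      where open ≤-Reasoning

    -- By parity the row of a leaf in rest has the same sum as in adj.
    leaf-rest : ∀ {v w} → degree G v ≡ 1 → v ~ w → rest v w ≡ 1
    leaf-rest {v} {w} deg≡1 vw with rest-parity v
    ... | zero  , parity = trans (sum-≥⇒≡ (rest≤adj v) (≤-reflexive (trans (sym parity) (+-identityʳ _))) w) (𝟙-yes (v ~? w) vw)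
    ... | suc k , parity = contradiction (begin
      2                            ≤⟨ *-monoʳ-≤ 2 (s≤s z≤n) ⟩
      2 * suc k                    ≤⟨ m≤n+m _ (sum (rest v)) ⟩
      sum (rest v) + 2 * suc k     ≡⟨ trans parity (trans (sym (degree-sum v)) deg≡1) ⟩
      1                            ∎) 1+n≰n
      where open ≤-Reasoning

    module _ (conn : Connected G) (3≤n : 3 ℕ.≤ n) where

      private
        leaf : Fin n → ℕ
        leaf v = 𝟙 (degree G v ≟ 1)

      -- At most one end of an edge is a leaf, and an edge at a leaf survives in `rest`.
      leaf-edges : ∀ v w → leaf v * adj G v w + leaf w * adj G v w ℕ.≤ rest v w
      leaf-edges v w = cases (v ~? w) (degree G v ≟ 1) (degree G w ≟ 1)
        where
        cases : (a : Dec (v ~ w)) (b : Dec (degree G v ≡ 1)) (c : Dec (degree G w ≡ 1)) →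
          𝟙 b * 𝟙 a + 𝟙 c * 𝟙 a ℕ.≤ rest v w
        cases (no _)   b        c        rewrite *-zeroʳ (𝟙 b) | *-zeroʳ (𝟙 c) = z≤n
        cases (yes vw) (yes dv) (yes dw) = contradiction vw (leaves-nonadjacent conn 3≤n dv dw)
        cases (yes vw) (yes dv) (no _)   = ≤-reflexive (sym (leaf-rest dv vw))
        cases (yes vw) (no _)   (yes dw) = ≤-reflexive (sym (trans (rest-sym v w) (leaf-rest dw (~-sym vw))))
        cases (yes _)  (no _)   (no _)   = z≤n

      leaf-row : ∀ v → ∑[ w < n ] (leaf v * adj G v w) ≡ leaf v
      leaf-row v = trans (sym (*-distribˡ-sum (leaf v) (adj G v)))
        (trans (cong (leaf v *_) (sym (degree-sum v))) (𝟙-≡1-* (degree G v ≟ 1)))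

      -- The edge at a leaf contributes twice to `rest`: in the row of the leaf (`from`) and in its
      -- column (`to`).
      leaves≤rest : 2 * μ₁ (degreeSequence G) ℕ.≤ total G rest
      leaves≤rest = begin
        2 * μ₁ (degreeSequence G)                  ≡⟨ cong (2 *_) (count-map-allFin (_≟ 1) (degree G)) ⟩
        2 * sum leaf                               ≡⟨ cong (sum leaf +_) (+-identityʳ _) ⟩
        sum leaf + sum leaf                        ≡⟨ cong₂ _+_ (sym from) (sym to) ⟩
        ∑[ v < n ] ∑[ w < n ] (leaf v * adj G v w) + ∑[ v < n ] ∑[ w < n ] (leaf w * adj G v w)
          ≡⟨ sym (∑-distrib-+ (λ v → ∑[ w < n ] (leaf v * adj G v w)) _) ⟩
        ∑[ v < n ] (∑[ w < n ] (leaf v * adj G v w) + ∑[ w < n ] (leaf w * adj G v w))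
          ≡⟨ sum-cong-≗ (λ v → sym (∑-distrib-+ (λ w → leaf v * adj G v w) _)) ⟩
        ∑[ v < n ] ∑[ w < n ] (leaf v * adj G v w + leaf w * adj G v w)
          ≤⟨ sum-mono-≤ (λ v → sum-mono-≤ (leaf-edges v)) ⟩
        total G rest                               ∎
        where
        open ≤-Reasoning
        from : ∑[ v < n ] ∑[ w < n ] (leaf v * adj G v w) ≡ sum leaf
        from = sum-cong-≗ leaf-row
        to : ∑[ v < n ] ∑[ w < n ] (leaf w * adj G v w) ≡ sum leaf
        to = trans (∑-comm (λ v w → leaf w * adj G v w))
          (sum-cong-≗ λ w → trans (sum-cong-≗ λ v → cong (leaf w *_) (adj-sym G v w)) (leaf-row w))

  edgeList-decomposition : IsCactus G → Bipartite G → Decomposition G edgeList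
  edgeList-decomposition cactus bip =
    decompose G cactus bip edgeList (All.all-filter edge? (cartesianProduct (allFin n) (allFin n)))
      (Unique.filter⁺ edge? (Unique.cartesianProduct⁺ (Unique.allFin⁺ n) (Unique.allFin⁺ n)))

-- The edge bound with floor and maximum

open import Data.Integer.Base using (+_)

theorem4p13 : (n : ℕ) (G : SimpleGraph n) →
    4 ℕ.≤ n → IsCactus G → Bipartite G →
    1ℚ ≤ β (degreeSequence G) →
    + edgeCount G ℤ.≤ floor (((+ 4 ℤ.* (+ n ℤ.- + 1)) / 1 - β (degreeSequence G)) ÷ (+ 3 / 1))
theorem4p13 (suc k) G 4≤n cactus bip _ =
  -- As `n` is `suc k`, the term `+ n - + 1` computes to `+ k`, and the numerator `4 * k` is written
  -- as `m * 3 + t`. It remains to bound both arguments of the maximum by `t`.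
  subst (λ i → + m ℤ.≤ floor ((i / 1 - β d) ÷ (+ 3 / 1))) (trans (cong ℤ.+_ m*3+t≡4k) (ℤ.pos-* 4 k))
    (Rounding.floor-÷3-greatest m t (β d) (ℚ.⊔-lub
      (Rounding./-mono-≤ (μ₁ d) 1 t 1 (*-monoˡ-≤ 1 μ₁≤t))
      (Rounding./-mono-≤ (μ₁ d + μodd d) 2 t 1 (subst (ℕ._≤ t * 2) (sym (*-identityʳ _)) μ₁+μodd≤2t))))
  where
  d = degreeSequence G
  m = edgeCount G
  D = edgeList-decomposition G cactus bip
  B = total G (Decomposition.rest D)
  -- The slack of the bound without β; `m*3≤4k` shows that the subtraction does not truncate.
  t = 4 * k ∸ m * 3

  B+6m≤8k : B + 6 * m ℕ.≤ 8 * k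
  -- The vertex `zero` exists because `n` is `suc k`, and 8 cancels from `8 * suc k`.
  B+6m≤8k = +-cancelʳ-≤ 8 _ _ (≤-trans (edgeCount-bound G D zero) (≤-reflexive (trans (*-suc 8 k) (+-comm 8 (8 * k)))))

  module _ where
    open +-*-Solver
    open ≤-Reasoning

    m*3≤4k : m * 3 ℕ.≤ 4 * k
    m*3≤4k = *-cancelˡ-≤ 2 (begin
      2 * (m * 3)   ≡⟨ solve 1 (λ m → con 2 :* (m :* con 3) := con 6 :* m) refl m ⟩
      6 * m         ≤⟨ m≤n+m (6 * m) B ⟩
      B + 6 * m     ≤⟨ B+6m≤8k ⟩
      8 * k         ≡⟨ *-assoc 2 4 k ⟩
      2 * (4 * k)   ∎)

    m*3+t≡4k : m * 3 + t ≡ 4 * k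
    m*3+t≡4k = m+[n∸m]≡n m*3≤4k

    B≤2t : B ℕ.≤ t * 2
    B≤2t = +-cancelʳ-≤ (6 * m) _ _ (begin
      B + 6 * m           ≤⟨ B+6m≤8k ⟩
      8 * k               ≡⟨ *-assoc 2 4 k ⟩
      2 * (4 * k)         ≡⟨ cong (2 *_) m*3+t≡4k ⟨
      2 * (m * 3 + t)     ≡⟨ solve 2 (λ m t → con 2 :* (m :* con 3 :+ t) := t :* con 2 :+ con 6 :* m) refl m t ⟩
      t * 2 + 6 * m       ∎)

    μ₁≤t : μ₁ d ℕ.≤ t
    μ₁≤t = *-cancelˡ-≤ 2 (begin
      2 * μ₁ d   ≤⟨ leaves≤rest G D (IsCactus.connected cactus) (≤-trans (n≤1+n 3) 4≤n) ⟩
      B          ≤⟨ B≤2t ⟩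
      t * 2      ≡⟨ *-comm t 2 ⟩
      2 * t      ∎)

  μ₁+μodd≤2t : μ₁ d + μodd d ℕ.≤ t * 2
  μ₁+μodd≤2t = ≤-trans (odd≤rest G D) B≤2t
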